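{- The useless arc rule is correct: whenever $\mathcal N_2$ is obtained from a negotiation $\mathcal N_1$ by one application of the useless arc rule, $\mathcal N_2$ is equivalent to $\mathcal N_1$.
   Context: Fix a finite set $\mathcal A$ of agents; each $p\in\mathcal A$ has a nonempty set $Q_p$ of internal states, and $Q_{\mathcal A}=\prod_{p\in\mathcal A}Q_p$. A transformer is a left-total relation $\tau\subseteq Q_{\mathcal A}\times Q_{\mathcal A}$; a $P$-transformer ($P\subseteq\mathcal A$) is a transformer such that $(q,q')\in\tau$ implies $q_p=q'_p$ for all $p\notin P$. Concatenation $\tau_1\tau_2$ is relational composition (first $\tau_1$, then $\tau_2$). An atom is a triple $n=(P_n,R_n,\delta_n)$ with $\emptyset\ne P_n\subseteq\mathcal A$ (parties), $R_n$ a finite nonempty set of results, and $\delta_n$ assigning to each $r\in R_n$ a $P_n$-transformer $\delta_n(r)$. Pairs $(n,r)$ with $r\in R_n$ are outcomes. For a finite set $N$ of atoms let $T(N)=\{(n,p,r): n\in N,\ p\in P_n,\ r\in R_n\}$. A negotiation is a tuple $\mathcal N=(N,n_0,n_f,\mathcal X)$ with $n_0,n_f\in N$ and $\mathcal X:T(N)\to 2^N$, such that: (1) $P_{n_0}=P_{n_f}=\mathcal A$; (2) $\mathcal X(n,p,r)=\emptyset$ iff $n=n_f$; (3) every atom lies on some path from $n_0$ to $n_f$, where a path is a sequence $(n_1,p_1,r_1)\cdots(n_k,p_k,r_k)$ in $T(N)$ with $n_{i+1}\in\mathcal X(n_i,p_i,r_i)$ for $1\le i\le k-1$. Convention: every atom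 in $\mathcal X(n,p,r)$ has $p$ as a party. An arc is a tuple $(n,p,r,n')$ with $(n,p,r)\in T(N)$ and $n'\in\mathcal X(n,p,r)$. A marking is a map $x:\mathcal A\to 2^N$; initial marking $x_0(p)=\{n_0\}$, final marking $x_f(p)=\emptyset$ for all $p$. A marking $x$ enables $n$ if $n\in x(p)$ for all $p\in P_n$; then for every $r\in R_n$ the outcome $(n,r)$ can occur, leading to $x'$ with $x'(p)=\mathcal X(n,p,r)$ for $p\in P_n$ and $x'(p)=x(p)$ otherwise. Occurrence sequences are finite sequences of outcomes occurring successively from a marking; a marking is reachable if an occurrence sequence leads to it from $x_0$. A large step is an occurrence sequence from $x_0$ to $x_f$. $\mathcal N$ is sound if (a) every atom is enabled at some reachable marking, and (b) every occurrence sequence from $x_0$ is a large step or can be extended to one. Final results are the results of $n_f$. For a final result $r$, the summary transformer $\langle\mathcal N,r\rangle$ is the union, over all large steps $(n_1,r_1)\cdots(n_k,r_k)$ ending with $(n_f,r)$, of $\delta_{n_1}(r_1)\cdots\delta_{n_k}(r_k)$. Two negotiations over the same agents are equivalent if they are both sound or both unsound, have the same final results, and have the same summary transformer for every final result. Useless arc rule. Guard: there are three distinct arcs $(n,p,r,n')$, $(n,p,r,n'')$, $(n,q,r,n')$ such that $\mathcal X(n,q,r)=\{n'\}$ and $q$ is a party of both $n'$ and $n''$; and the tuple obtained by the action below is again a negotiation (satisfies (1)-(3)). Action: $\mathcal X(n,p,r)\leftarrow\mathcal X(n,p,r)\setminus\{n''\}$. -}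

module Defs where

open import Data.Bool.Base using (if_then_else_)
open import Data.Fin.Base using (Fin)
import Data.Fin.Properties as Fin
open import Data.Fin.Subset using (Subset; _∈_; _∉_; _-_; ⁅_⁆; ⊤; ⊥; Nonempty)
open import Data.Fin.Subset.Properties using (_∈?_)
open import Data.List.Base using (List; []; _∷_; _++_; _∷ʳ_; foldr; map; head; last)
import Data.List.Membership.Propositional as List
open import Data.List.Relation.Unary.Linked using (Linked)
open import Data.Maybe.Base using (just)
open import Data.Nat.Base using (ℕ)
open import Data.Product.Base using (∃; ∃-syntax; _×_; _,_)
open import Data.Sum.Base using (_⊎_)
open import Function.Bundles using (_⇔_)
open import Level using (Level; suc)
open import Relation.Binary.Construct.Composition using (_;_)
open import Relation.Binary.Core using (Rel) renaming (_⇔_ to _⇔ʳ_)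
open import Relation.Binary.Definitions using (DecidableEquality; _Respects₂_)
open import Relation.Binary.PropositionalEquality.Core using (_≡_; _≢_; _≗_; refl)
open import Relation.Nullary.Decidable using (does; yes; no; map′; _×-dec_)

-- Results are drawn from a common finite alphabet Fin #results, so that the
-- result sets of different atoms and of different negotiations can be compared.
record Setting (ℓ : Level) : Set (suc ℓ) where
  field
    #agents  : ℕ
    #results : ℕ
    Q        : Fin #agents → Set ℓ
    Q-inhabited : ∀ p → Q p

  Agent : Set
  Agent = Fin #agents

  Result : Set
  Result = Fin #results

  State : Set ℓ
  State = ∀ p → Q p

  infix 4 _≈_

  _≈_ : Rel State ℓ
  q ≈ q′ = ∀ p → q p ≡ q′ p

open Setting

-- Elements of a product are equal iff they agree in every component; as State
-- is a function type, `resp` says that rel is a relation up to that equality.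
record Transformer {ℓ} (S : Setting ℓ) : Set (suc ℓ) where
  field
    rel   : Rel (State S) ℓ
    total : ∀ q → ∃[ q′ ] rel q q′
    resp  : rel Respects₂ _≈_ S

open Transformer

record PTransformer {ℓ} (S : Setting ℓ) (P : Subset (#agents S)) : Set (suc ℓ) where
  field
    transformer : Transformer S
    local : ∀ {q q′} → rel transformer q q′ → ∀ p → p ∉ P → q p ≡ q′ p

open PTransformer

-- Membership proofs are irrelevant arguments throughout, so that nothing
-- depends on which proof is given.
record Atom {ℓ} (S : Setting ℓ) : Set (suc ℓ) where
  field
    parties          : Subset (#agents S)
    parties-nonempty : Nonempty parties
    results          : Subset (#results S)
    results-nonempty : Nonempty results
    δ                : ∀ r → .(r ∈ results) → PTransformer S parties

open Atom

-- T(N) for the finite family `atoms` of atoms; an atom is identified with its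
-- index.
record T {ℓ} {S : Setting ℓ} {m} (atoms : Fin m → Atom S) : Set where
  constructor triple
  field
    atom     : Fin m
    party    : Agent S
    result   : Result S
    .party∈  : party ∈ parties (atoms atom)
    .result∈ : result ∈ results (atoms atom)

_≟_ : ∀ {ℓ} {S : Setting ℓ} {m} {atoms : Fin m → Atom S} → DecidableEquality (T atoms)
triple n p r _ _ ≟ triple n′ p′ r′ _ _ =
  map′ (λ { (refl , refl , refl) → refl }) (λ { refl → refl , refl , refl })
       (n Fin.≟ n′ ×-dec p Fin.≟ p′ ×-dec r Fin.≟ r′)

record Outcome {ℓ} {S : Setting ℓ} {m} (atoms : Fin m → Atom S) : Set where
  constructor outcome
  field
    atom     : Fin m
    result   : Result S
    .result∈ : result ∈ results (atoms atom)

-- The bare tuple (N, n₀, n_f, 𝒳), before conditions are imposed.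
record Tuple {ℓ} (S : Setting ℓ) : Set (suc ℓ) where
  field
    #atoms : ℕ
    atoms  : Fin #atoms → Atom S
    n₀ n-f : Fin #atoms
    𝒳      : T atoms → Subset #atoms

  AtomIx : Set
  AtomIx = Fin #atoms

  P : AtomIx → Subset (#agents S)
  P n = parties (atoms n)

  R : AtomIx → Subset (#results S)
  R n = results (atoms n)

  IsPath : List (T atoms) → Set
  IsPath = Linked (λ t t′ → T.atom t′ ∈ 𝒳 t)

  OnPathFrom_To_ : AtomIx → AtomIx → AtomIx → Set
  (OnPathFrom n₁ To n₂) n = ∃[ π ] IsPath π
    × head (map T.atom π) ≡ just n₁
    × last (map T.atom π) ≡ just n₂
    × n List.∈ map T.atom π

record IsNegotiation {ℓ} {S : Setting ℓ} (N : Tuple S) : Set where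
  open Tuple N
  field
    P-n₀       : P n₀ ≡ ⊤
    P-n-f      : P n-f ≡ ⊤
    𝒳-empty    : ∀ t → 𝒳 t ≡ ⊥ ⇔ T.atom t ≡ n-f
    on-path    : ∀ n → (OnPathFrom n₀ To n-f) n
    𝒳-party    : ∀ t n′ → n′ ∈ 𝒳 t → T.party t ∈ P n′

record Negotiation {ℓ} (S : Setting ℓ) : Set (suc ℓ) where
  field
    tuple         : Tuple S
    isNegotiation : IsNegotiation tuple

  open Tuple tuple public
  open IsNegotiation isNegotiation public

module Semantics {ℓ} {S : Setting ℓ} (N : Negotiation S) where
  open Negotiation N

  Marking : Set
  Marking = Agent S → Subset #atoms

  x₀ : Marking
  x₀ _ = ⁅ n₀ ⁆

  x-f : Marking
  x-f _ = ⊥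

  Enables : Marking → AtomIx → Set
  Enables x n = ∀ p → p ∈ P n → n ∈ x p

  fire : Outcome atoms → Marking → Marking
  fire (outcome n r r∈) x p with p ∈? P n
  ... | yes p∈ = 𝒳 (triple n p r p∈ r∈)
  ... | no  _  = x p

  data _[_⟩_ : Marking → List (Outcome atoms) → Marking → Set where
    []  : ∀ {x} → x [ [] ⟩ x
    _∷_ : ∀ {x x′ o σ} → Enables x (Outcome.atom o) →
          fire o x [ σ ⟩ x′ → x [ o ∷ σ ⟩ x′

  Reachable : Marking → Set
  Reachable x = ∃[ σ ] x₀ [ σ ⟩ x

  IsOccurrenceSequence : List (Outcome atoms) → Set
  IsOccurrenceSequence σ = ∃[ x ] x₀ [ σ ⟩ x

  IsLargeStep : List (Outcome atoms) → Set
  IsLargeStep σ = ∃[ x ] x₀ [ σ ⟩ x × x ≗ x-f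

  Sound : Set
  Sound = (∀ n → ∃[ x ] Reachable x × Enables x n)
        × (∀ σ → IsOccurrenceSequence σ →
             IsLargeStep σ ⊎ ∃[ σ′ ] IsLargeStep (σ ++ σ′))

  δ-outcome : Outcome atoms → Rel (State S) ℓ
  δ-outcome (outcome n r r∈) = rel (transformer (δ (atoms n) r r∈))

  δ-sequence : List (Outcome atoms) → Rel (State S) ℓ
  δ-sequence = foldr (λ o τ → δ-outcome o ; τ) (_≈_ S)

  finalResults : Subset (#results S)
  finalResults = R n-f

  summary : ∀ r → .(r ∈ finalResults) → Rel (State S) ℓ
  summary r r∈ q q′ = ∃[ σ ] IsLargeStep (σ ∷ʳ final) × δ-sequence (σ ∷ʳ final) q q′
    where
    final : Outcome atoms
    final = outcome n-f r r∈

-- "Both sound or both unsound" is read as logical equivalence of soundness.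
record Equivalent {ℓ} {S : Setting ℓ} (N₁ N₂ : Negotiation S) : Set ℓ where
  private
    module N₁ = Semantics N₁
    module N₂ = Semantics N₂
  field
    sound   : N₁.Sound ⇔ N₂.Sound
    final   : N₁.finalResults ≡ N₂.finalResults
    summary : ∀ r (r∈₁ : r ∈ N₁.finalResults) (r∈₂ : r ∈ N₂.finalResults) →
              N₁.summary r r∈₁ ⇔ʳ N₂.summary r r∈₂

removeArc : ∀ {ℓ} {S : Setting ℓ} (N : Tuple S) → T (Tuple.atoms N) → Tuple.AtomIx N → Tuple S
removeArc N t n″ = record
  { atoms = atoms
  ; n₀    = n₀
  ; n-f   = n-f
  ; 𝒳     = λ s → if does (s ≟ t) then 𝒳 s - n″ else 𝒳 s
  }
  where open Tuple N

-- The arcs (n,p,r,n′), (n,p,r,n″), (n,q,r,n′) are distinct exactly when p ≢ q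
-- and n′ ≢ n″.  That the modified tuple is again a negotiation is part of the
-- guard: it is expressed by N₂ being a Negotiation.
record UselessArcRule {ℓ} {S : Setting ℓ} (N₁ N₂ : Negotiation S) : Set (suc ℓ) where
  open Negotiation N₁
  field
    n n′ n″  : AtomIx
    p q      : Agent S
    r        : Result S
    p∈       : p ∈ P n
    q∈       : q ∈ P n
    r∈       : r ∈ R n
    arc₁     : n′ ∈ 𝒳 (triple n p r p∈ r∈)
    arc₂     : n″ ∈ 𝒳 (triple n p r p∈ r∈)
    arc₃     : n′ ∈ 𝒳 (triple n q r q∈ r∈)
    p≢q      : p ≢ q
    n′≢n″    : n′ ≢ n″
    𝒳-nqr    : 𝒳 (triple n q r q∈ r∈) ≡ ⁅ n′ ⁆
    q∈n′     : q ∈ P n′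
    q∈n″     : q ∈ P n″
    action   : Negotiation.tuple N₂ ≡ removeArc tuple (triple n p r p∈ r∈) n″

{-# OPTIONS --safe #-}

-- After (n , r) occurs, q sits at {n′} and only n′ can move it; since p is a
-- party of n′, agent q stays there as long as p keeps the set 𝒳(n,p,r).  All
-- that time n″, which has q as a party, is disabled.  Hence both negotiations
-- have the same occurrence sequences, leading to markings that are related by _∼_.

module Submission where

open import Defs

open import Data.Bool.Base using (if_then_else_)
open import Data.Fin.Base using (Fin)
import Data.Fin.Properties as Fin
open import Data.Fin.Subset using (_∈_; _∉_; _-_; ⁅_⁆; ⊥)
open import Data.Fin.Subset.Properties
  using (_∈?_; x∈⁅x⁆; x∈⁅y⁆⇒x≡y; ∉⊥; p─q⊆p; x∈p∧x≢y⇒x∈p-y)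
open import Data.Product.Base using (∃-syntax; _×_; _,_; proj₁; map₂)
open import Data.Sum.Base using (_⊎_; inj₁; inj₂) renaming (map to ⊎-map)
open import Function.Base using (_∘_; id)
open import Function.Bundles using (_⇔_; mk⇔; Equivalence)
open import Relation.Binary.PropositionalEquality
  using (_≡_; _≢_; _≗_; refl; sym; trans; subst)
open import Relation.Nullary using (¬_; Dec; does; yes; no; contradiction)
open import Relation.Nullary.Negation.Core using (contradiction-irr)

open Equivalence using (to; from)

⁅⁆≢⊥ : ∀ {m} {i : Fin m} → ⁅ i ⁆ ≢ ⊥
⁅⁆≢⊥ {i = i} eq = ∉⊥ (subst (i ∈_) eq (x∈⁅x⁆ i))

≗-splitAt : ∀ {m a} {A : Set a} {f g : Fin m → A} i →
            (∀ j → j ≢ i → f j ≡ g j) → f i ≡ g i → f ≗ g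
≗-splitAt i off at j with j Fin.≟ i
... | yes refl = at
... | no  j≢i  = off j j≢i

if-dec : ∀ {a b} {A : Set a} {B : Set b} {x y : B} (A? : Dec A) →
         A × (if does A? then x else y) ≡ x ⊎ ¬ A × (if does A? then x else y) ≡ y
if-dec (yes a) = inj₁ (a , refl)
if-dec (no ¬a) = inj₂ (¬a , refl)

-- Stated as a disjunction so that matching its equation with `refl` identifies atom, party and
-- result at once.
𝒳-removeArc : ∀ {ℓ} {S : Setting ℓ} (N : Tuple S) t n″ s → let open Tuple N in
  s ≡ t × Tuple.𝒳 (removeArc N t n″) s ≡ 𝒳 s - n″ ⊎
  s ≢ t × Tuple.𝒳 (removeArc N t n″) s ≡ 𝒳 s
𝒳-removeArc N t n″ s = if-dec (s ≟ t)

module _ {ℓ} {S : Setting ℓ} (N : Negotiation S) where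
  open Negotiation N
  open Semantics N

  -- `party∈` is irrelevant, so the proof found by `∈?` and the given one form the same triple.
  fire-∈ : ∀ {m c} .(c∈ : c ∈ R m) {x a} .(a∈ : a ∈ P m) →
           fire (outcome m c c∈) x a ≡ 𝒳 (triple m a c a∈ c∈)
  fire-∈ {m} _ {a = a} a∈ with a ∈? P m
  ... | yes _  = refl
  ... | no  a∉ = contradiction-irr a∈ a∉

  fire-∉ : ∀ {m c} .(c∈ : c ∈ R m) {x a} → a ∉ P m →
           fire (outcome m c c∈) x a ≡ x a
  fire-∉ {m} _ {a = a} a∉ with a ∈? P m
  ... | yes a∈ = contradiction a∈ a∉
  ... | no  _  = refl

module RemoveUselessArc
  {ℓ} {S : Setting ℓ} (N₁ : Negotiation S)
  {n n′ n″ : Negotiation.AtomIx N₁} {p q : Setting.Agent S} {r : Setting.Result S}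
  (p∈ : p ∈ Negotiation.P N₁ n) (q∈ : q ∈ Negotiation.P N₁ n) (r∈ : r ∈ Negotiation.R N₁ n)
  (arc₁ : n′ ∈ Negotiation.𝒳 N₁ (triple n p r p∈ r∈)) (p≢q : p ≢ q) (n′≢n″ : n′ ≢ n″)
  (𝒳-nqr : Negotiation.𝒳 N₁ (triple n q r q∈ r∈) ≡ ⁅ n′ ⁆)
  (q∈n″ : q ∈ Negotiation.P N₁ n″)
  (isNegotiation₂ : IsNegotiation (removeArc (Negotiation.tuple N₁) (triple n p r p∈ r∈) n″))
  where

  open Negotiation N₁

  t : T atoms
  t = triple n p r p∈ r∈

  N₂ : Negotiation S
  N₂ = record { isNegotiation = isNegotiation₂ }

  module ₁ = Semantics N₁
  module ₂ = Semantics N₂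

  infix 4 _∼_

  -- The second alternative describes the time from an occurrence of `(n , r)` until `p` moves
  -- again; its condition on `q` is what keeps `n″` disabled meanwhile.
  _∼_ : ₁.Marking → ₂.Marking → Set
  x ∼ y = (∀ a → a ≢ p → x a ≡ y a)
        × (x p ≡ y p ⊎ y p ≡ x p - n″ × x q ≡ ⁅ n′ ⁆)

  p∈n′ : p ∈ P n′
  p∈n′ = 𝒳-party t n′ arc₁

  -- Only `n″` could be lost, but its party `q` is ready for `n′` alone, so `x` does not enable it.
  -- Conversely, `y p` is contained in `x p`.
  ∼⇒enables : ∀ {x y m} → x ∼ y → ₁.Enables x m ⇔ ₂.Enables y m
  ∼⇒enables {x} {y} {m} (off-p , inj₁ at-p) = mk⇔
    (λ e a a∈ → subst (m ∈_) (x≗y a) (e a a∈))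
    (λ e a a∈ → subst (m ∈_) (sym (x≗y a)) (e a a∈))
    where
    x≗y : x ≗ y
    x≗y = ≗-splitAt p off-p at-p
  ∼⇒enables {x} {y} {m} (off-p , inj₂ (yp , xq)) = mk⇔ forth back
    where
    m≢n″ : ₁.Enables x m → m ≢ n″
    m≢n″ e refl = n′≢n″ (sym (x∈⁅y⁆⇒x≡y n′ (subst (n″ ∈_) xq (e q q∈n″))))

    forth : ₁.Enables x m → ₂.Enables y m
    forth e a a∈ with a Fin.≟ p
    ... | no  a≢p  = subst (m ∈_) (off-p a a≢p) (e a a∈)
    ... | yes refl = subst (m ∈_) (sym yp) (x∈p∧x≢y⇒x∈p-y (e p a∈) (m≢n″ e))

    back : ₂.Enables y m → ₁.Enables x m
    back e a a∈ with a Fin.≟ p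
    ... | no  a≢p  = subst (m ∈_) (sym (off-p a a≢p)) (e a a∈)
    ... | yes refl = p─q⊆p (x p) ⁅ n″ ⁆ (subst (m ∈_) yp (e p a∈))

  fire-∼ : ∀ {x y} o → x ∼ y → ₁.Enables x (Outcome.atom o) → ₁.fire o x ∼ ₂.fire o y
  fire-∼ {x} {y} o@(outcome m c c∈) (off-p , at-p) e = off-p′ , at-p′
    where
    off-p′ : ∀ a → a ≢ p → ₁.fire o x a ≡ ₂.fire o y a
    off-p′ a a≢p with a ∈? P m
    ... | no  _  = off-p a a≢p
    ... | yes a∈ with 𝒳-removeArc tuple t n″ (triple m a c a∈ c∈)
    ...   | inj₁ (refl , _) = contradiction refl a≢p
    ...   | inj₂ (_ , eq)   = sym eq

    at-p′ : ₁.fire o x p ≡ ₂.fire o y p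
          ⊎ ₂.fire o y p ≡ ₁.fire o x p - n″ × ₁.fire o x q ≡ ⁅ n′ ⁆
    at-p′ with p ∈? P m
    ... | yes p∈m with 𝒳-removeArc tuple t n″ (triple m p c p∈m c∈)
    -- The outcome is `(n , r)`: whatever held before, `q` moves along with `p` and is sent to `n′`
    -- only.
    ...   | inj₁ (refl , eq) = inj₂ (eq , trans (fire-∈ N₁ c∈ q∈) 𝒳-nqr)
    ...   | inj₂ (_ , eq)    = inj₁ (sym eq)
    at-p′ | no p∉m = ⊎-map id
      (λ (yp , xq) → yp , trans (fire-∉ N₁ c∈ (q∉m xq)) xq) at-p
      where
      -- An enabled atom that moves `q` can only be `n′`, which would move `p` as well.
      q∉m : x q ≡ ⁅ n′ ⁆ → q ∉ P m
      q∉m xq q∈m with x∈⁅y⁆⇒x≡y n′ (subst (m ∈_) xq (e q q∈m))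
      ... | refl = p∉m p∈n′

  -- In the second alternative neither marking is final: as `q` differs from `p`, both give `q` the
  -- nonempty set `⁅ n′ ⁆`.
  ∼⇒final : ∀ {x y} → x ∼ y → x ≗ ₁.x-f ⇔ y ≗ ₂.x-f
  ∼⇒final {x} {y} (off-p , inj₁ at-p) =
    mk⇔ (λ x⊥ a → trans (sym (x≗y a)) (x⊥ a)) (λ y⊥ a → trans (x≗y a) (y⊥ a))
    where
    x≗y : x ≗ y
    x≗y = ≗-splitAt p off-p at-p
  ∼⇒final (off-p , inj₂ (_ , xq)) =
    mk⇔ (λ x⊥ → contradiction (trans (sym xq) (x⊥ q)) ⁅⁆≢⊥)
        (λ y⊥ → contradiction
          (trans (sym (trans (sym (off-p q (p≢q ∘ sym))) xq)) (y⊥ q)) ⁅⁆≢⊥)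

  x₀∼x₀ : ₁.x₀ ∼ ₂.x₀
  x₀∼x₀ = (λ _ _ → refl) , inj₁ refl

  -- Both runs use the same `σ`, and the atoms are unchanged, so `δ-sequence` of `σ` is the same
  -- relation on both sides; the summaries rely on this.
  simulate : ∀ {x y x′ σ} → x ∼ y → x ₁.[ σ ⟩ x′ → ∃[ y′ ] y ₂.[ σ ⟩ y′ × x′ ∼ y′
  simulate x∼y ₁.[] = _ , ₂.[] , x∼y
  simulate x∼y (₁._∷_ {o = o} e run) =
    let y′ , run′ , x′∼y′ = simulate (fire-∼ o x∼y e) run
    in  y′ , to (∼⇒enables x∼y) e ₂.∷ run′ , x′∼y′

  cosimulate : ∀ {x y y′ σ} → x ∼ y → y ₂.[ σ ⟩ y′ → ∃[ x′ ] x ₁.[ σ ⟩ x′ × x′ ∼ y′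
  cosimulate x∼y ₂.[] = _ , ₁.[] , x∼y
  cosimulate x∼y (₂._∷_ {o = o} e₂ run) =
    -- Enabledness is pulled back first, because `fire-∼` asks for it in `x`.
    let e₁ = from (∼⇒enables x∼y) e₂
        x′ , run′ , x′∼y′ = cosimulate (fire-∼ o x∼y e₁) run
    in  x′ , e₁ ₁.∷ run′ , x′∼y′

  isOccurrenceSequence : ∀ {σ} → ₁.IsOccurrenceSequence σ ⇔ ₂.IsOccurrenceSequence σ
  isOccurrenceSequence = mk⇔
    (λ (_ , run) → map₂ proj₁ (simulate x₀∼x₀ run))
    (λ (_ , run) → map₂ proj₁ (cosimulate x₀∼x₀ run))

  isLargeStep : ∀ {σ} → ₁.IsLargeStep σ ⇔ ₂.IsLargeStep σ
  isLargeStep = mk⇔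
    (λ (_ , run , fin) → map₂ (map₂ λ x∼y → to (∼⇒final x∼y) fin) (simulate x₀∼x₀ run))
    (λ (_ , run , fin) → map₂ (map₂ λ x∼y → from (∼⇒final x∼y) fin) (cosimulate x₀∼x₀ run))

  sound : ₁.Sound ⇔ ₂.Sound
  sound = mk⇔
    (λ (enabled , extendable) →
      (λ m → let _ , (σ , run) , e = enabled m
                 y , run′ , x∼y = simulate x₀∼x₀ run
             in  y , (σ , run′) , to (∼⇒enables x∼y) e) ,
      -- The sequence is carried back to `N₁`, completed there, and the large step carried forward.
      (λ σ → ⊎-map (to isLargeStep) (map₂ (to isLargeStep))
               ∘ extendable σ ∘ from isOccurrenceSequence))
    (λ (enabled , extendable) →
      (λ m → let _ , (σ , run) , e = enabled m
                 x , run′ , x∼y = cosimulate x₀∼x₀ run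
             in  x , (σ , run′) , from (∼⇒enables x∼y) e) ,
      (λ σ → ⊎-map (from isLargeStep) (map₂ (from isLargeStep))
               ∘ extendable σ ∘ to isOccurrenceSequence))

  equivalent : Equivalent N₂ N₁
  equivalent = record
    { sound   = mk⇔ (from sound) (to sound)
    ; final   = refl
    ; summary = λ _ _ _ →
        (λ (σ , large , δσ) → σ , from isLargeStep large , δσ) ,
        (λ (σ , large , δσ) → σ , to isLargeStep large , δσ)
    }

theorem18 : ∀ {ℓ} (S : Setting ℓ) (N₁ N₂ : Negotiation S) →
    UselessArcRule N₁ N₂ → Equivalent N₂ N₁
-- Matching `action` with `refl` makes the tuple of the second negotiation the `removeArc` one, so
-- only its `isNegotiation` is left to pass on.
theorem18 S N₁ record { isNegotiation = isNegotiation₂ }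
  record { p∈ = p∈ ; q∈ = q∈ ; r∈ = r∈ ; arc₁ = arc₁ ; p≢q = p≢q ; n′≢n″ = n′≢n″
         ; 𝒳-nqr = 𝒳-nqr ; q∈n″ = q∈n″ ; action = refl } =
  RemoveUselessArc.equivalent N₁ p∈ q∈ r∈ arc₁ p≢q n′≢n″ 𝒳-nqr q∈n″ isNegotiation₂
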